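{- Let $G=(V,E,\omega)$ be a finite directed non-negatively weighted graph, $r\in V$ a root and $k\ge 1$ an integer. Algorithm Exh-S-kSSP (described in the context), run on input $(G,r,k)$, solves the Single-Source Top-$k$ Simple Shortest Paths problem: at termination, for every $v\in V\setminus\{r\}$ the list $T_v$ is a collection of top-$k$ simple shortest paths from $r$ to $v$.
   Context: $G=(V,E,\omega)$ is a finite directed graph, $E\subseteq V\times V$, with non-negative real edge weights $\omega$; $N^+(v)=\{u:(v,u)\in E\}$. A path from $s$ to $t$ is a vertex sequence $P=(s=v_1,\dots,v_\eta=t)$, $\eta\ge 1$, with $(v_i,v_{i+1})\in E$ for all $i<\eta$; $V(P)$ is its vertex set; it is simple if it has no repeated vertex; its weight is $\omega(P)=\sum_{i=1}^{\eta-1}\omega(v_i,v_{i+1})$. For a path $\Pi$ ending at $v$ and an edge $(v,u)$, $\Pi\oplus(u)$ is $\Pi$ extended by $u$. A collection of top-$k$ simple shortest paths from $r$ to $v$ is a set of pairwise distinct simple paths from $r$ to $v$ that contains all simple $r$–$v$ paths if there are fewer than $k$ of them, and otherwise contains exactly $k$ simple $r$–$v$ paths such that every simple $r$–$v$ path not in the set has weight at least that of every path in the set. The Single-Source Top-$k$ Simple Shortest Paths problem asks for such a collection for each $v\in V\setminus\{r\}$. Algorithm Exh-S-kSSP. Maintain a list $T_v$ for each $v\in V$ (initially empty) and a min-priority queue $PQ$ of paths keyed by weight, initially containing only the trivial path $(r)$ with key $0$. While $PQ\ne\emptyset$: remove from $PQ$ a path $\Pi=(r,\dots,v)$ of minimum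 weight; for each $u\in N^+(v)\setminus V(\Pi)$ insert $\Pi\oplus(u)$ into $PQ$ with key $\omega(\Pi)+\omega(v,u)$; if $|T_v|<k$, add $\Pi$ to $T_v$. -}

module Defs where

open import Algebra.Core using (Op₁; Op₂)
open import Algebra.Structures using (IsAbelianGroup)
open import Data.Fin.Base using (Fin)
open import Data.Fin.Properties using (_≟_)
open import Data.List.Base as List using (List; []; _∷_; _++_; length; filter; allFin)
open import Data.List.Membership.Propositional using (_∈_; _∉_)
open import Data.List.NonEmpty.Base using (List⁺; _∷_; toList; [_]; _⁺∷ʳ_; head)
open import Data.List.NonEmpty using (last)
open import Data.List.Relation.Binary.Permutation.Propositional using (_↭_)
open import Data.List.Relation.Unary.All using (All)
open import Data.List.Relation.Unary.Linked using (Linked)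
open import Data.List.Relation.Unary.Unique.Propositional using (Unique)
open import Data.Nat.Base as ℕ using (ℕ; _<ᵇ_)
open import Data.Bool.Base using (if_then_else_)
open import Data.Product.Base using (∃; _×_; _,_; proj₂)
open import Data.Vec.Functional using (Vector; updateAt)
open import Function.Base using (const)
open import Function.Bundles using (_⇔_)
open import Level using (Level; suc; _⊔_; 0ℓ)
open import Relation.Binary.Core using (Rel)
open import Relation.Binary.Construct.Closure.ReflexiveTransitive using (Star)
open import Relation.Binary.Definitions using (Decidable)
open import Relation.Binary.PropositionalEquality.Core using (_≡_)
open import Relation.Binary.Structures using (IsTotalOrder)
open import Relation.Nullary.Decidable using (¬?; _×-dec_)
open import Relation.Unary using (Pred)
import Data.List.Membership.DecPropositional as DecMembership

private
  variable
    a p c ℓ₁ ℓ₂ : Level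

-- The real numbers enter only through 0, addition and the total order, so
-- weights are taken in an arbitrary totally ordered abelian group.
record TotallyOrderedAbelianGroup c ℓ₁ ℓ₂ : Set (suc (c ⊔ ℓ₁ ⊔ ℓ₂)) where
  infix  4 _≈_ _≤_
  infixl 6 _+_
  field
    Carrier        : Set c
    _≈_            : Rel Carrier ℓ₁
    _≤_            : Rel Carrier ℓ₂
    _+_            : Op₂ Carrier
    0#             : Carrier
    -_             : Op₁ Carrier
    isAbelianGroup : IsAbelianGroup _≈_ _+_ 0# -_
    isTotalOrder   : IsTotalOrder _≈_ _≤_
    +-monoʳ-≤      : ∀ x {y z} → y ≤ z → x + y ≤ x + z

-- ω is total for convenience; its values on non-edges are unconstrained and
-- never contribute to the weight of a path.
record WeightedDigraph (W : TotallyOrderedAbelianGroup c ℓ₁ ℓ₂) : Set (suc 0ℓ ⊔ c ⊔ ℓ₂) where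
  open TotallyOrderedAbelianGroup W using (Carrier; _≤_; 0#)
  field
    order    : ℕ
  Vertex : Set
  Vertex = Fin order
  field
    Edge     : Rel Vertex 0ℓ
    edge?    : Decidable Edge
    ω        : Vertex → Vertex → Carrier
    ω-nonNeg : ∀ {u v} → Edge u v → 0# ≤ ω u v

HasCardinality : {A : Set a} → Pred A p → ℕ → Set (a ⊔ p)
HasCardinality P m = ∃ λ xs → Unique xs × (∀ x → P x ⇔ x ∈ xs) × length xs ≡ m

module _ {W : TotallyOrderedAbelianGroup c ℓ₁ ℓ₂} (G : WeightedDigraph W) where
  open TotallyOrderedAbelianGroup W
  open WeightedDigraph G
  open DecMembership (_≟_ {order}) using (_∈?_)

  VertexSeq : Set
  VertexSeq = List⁺ Vertex

  record IsPath (s t : Vertex) (P : VertexSeq) : Set where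
    field
      starts : head P ≡ s
      ends   : last P ≡ t
      linked : Linked Edge (toList P)

  IsSimplePath : Vertex → Vertex → Pred VertexSeq 0ℓ
  IsSimplePath s t P = IsPath s t P × Unique (toList P)

  weight : VertexSeq → Carrier
  weight (v ∷ vs) = go v vs
    where
    go : Vertex → List Vertex → Carrier
    go v []       = 0#
    go v (u ∷ us) = ω v u + go u us

  record IsTopKSimpleShortestPaths (k : ℕ) (r v : Vertex) (T : List VertexSeq) : Set ℓ₂ where
    field
      distinct : Unique T
      simple   : All (IsSimplePath r v) T
      -- m is the number of simple paths from r to v.
      topK     : ∃ λ m → HasCardinality (IsSimplePath r v) m
                 × (m ℕ.< k → ∀ {P} → IsSimplePath r v P → P ∈ T)
                 × (k ℕ.≤ m → length T ≡ k
                            × (∀ {P Q} → P ∈ T → IsSimplePath r v Q → Q ∉ T →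
                               weight P ≤ weight Q))

  -- The queue is a multiset of (path , key) pairs: the order of the list is
  -- immaterial, because extraction below works up to permutation.
  record State : Set c where
    constructor ⟨_,_⟩
    field
      T  : Vector (List VertexSeq) order
      PQ : List (VertexSeq × Carrier)

  open State public

  initial : Vertex → State
  initial r = ⟨ const [] , ([ r ] , 0#) ∷ [] ⟩

  -- N⁺(v) ∖ V(Π), where v is the last vertex of Π.
  freshNeighbours : VertexSeq → List Vertex
  freshNeighbours Π =
    filter (λ u → edge? (last Π) u ×-dec ¬? (u ∈? toList Π)) (allFin order)

  extensions : VertexSeq → List (VertexSeq × Carrier)
  extensions Π = List.map (λ u → Π ⁺∷ʳ u , weight Π + ω (last Π) u) (freshNeighbours Π)

  recordPath : ℕ → VertexSeq → List VertexSeq → List VertexSeq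
  recordPath k Π Ts = if length Ts <ᵇ k then Ts List.∷ʳ Π else Ts

  -- One iteration of the while loop. It is a relation because ties between
  -- entries of minimum key may be broken arbitrarily.
  data Step (k : ℕ) : State → State → Set (c ⊔ ℓ₂) where
    extractMin : ∀ {T PQ Π κ rest} →
                 PQ ↭ (Π , κ) ∷ rest →
                 All (λ e → κ ≤ proj₂ e) rest →
                 Step k ⟨ T , PQ ⟩
                        ⟨ updateAt T (last Π) (recordPath k Π) , extensions Π ++ rest ⟩

  Reachable : ℕ → Vertex → State → Set (c ⊔ ℓ₂)
  Reachable k r = Star (Step k) (initial r)

{-# OPTIONS --safe #-}
module Submission where

-- Let D be the list of all paths extracted so far, recorded or not.  Extracting Π inserts exactly
-- the children of Π, so D together with the queue is a permutation of [ r ] and the children of all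
-- members of D.  Hence no path is generated twice, and once the queue is empty D is closed under
-- extension and contains every simple path from r.  Non-negative weights make D sorted by weight,
-- and T v is always the first k members of D that end at v.

open import Defs
open import Algebra.Structures using (IsAbelianGroup)
open import Data.Bool.Base using (if_then_else_; true; false)
open import Data.Fin.Properties using (_≟_)
open import Data.List.Base
  using (List; []; _∷_; _++_; _∷ʳ_; length; filter; take; map; concatMap; allFin;
         initLast; _∷ʳ′_)
open import Data.List.Membership.Propositional using (_∈_; _∉_)
open import Data.List.Membership.Propositional.Properties
  using (∈-++⁻; ∈-++⁺ˡ; ∈-++⁺ʳ; ∈-map⁺; ∈-map⁻; ∈-filter⁺; ∈-filter⁻; ∈-concatMap⁺; ∈-concatMap⁻; ∈-allFin)
open import Data.List.NonEmpty.Base using (List⁺; _∷_; toList; [_]; _⁺∷ʳ_; last)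
open import Data.List.Properties
  using (++-assoc; ++-identityʳ; map-++; map-∘; concatMap-++; filter-++;
         length-take; length-map; length-filter; length-tabulate; take-all; take-[]; take++drop≡id;
         ∷ʳ-injective; ∷ʳ-++)
open import Data.List.Relation.Binary.Disjoint.Propositional using (Disjoint)
open import Data.List.Relation.Binary.Permutation.Propositional
  using (_↭_; prep; swap; ↭-refl; ↭-sym; ↭-trans; ↭⇒↭ₛ; module PermutationReasoning)
open import Data.List.Relation.Binary.Permutation.Propositional.Properties
  using (All-resp-↭; ∈-resp-↭; ∷↭∷ʳ; ++-comm; ++⁺ˡ; ++⁺ʳ)
  renaming (map⁺ to ↭-map⁺)
import Data.List.Relation.Binary.Permutation.Setoid.Properties as SetoidPermutation
open import Data.List.Relation.Unary.All as All using (All; []; _∷_)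
import Data.List.Relation.Unary.All.Properties as All
open import Data.List.Relation.Unary.AllPairs as AllPairs using (AllPairs; []; _∷_)
import Data.List.Relation.Unary.AllPairs.Properties as AllPairs
open import Data.List.Relation.Unary.Any as Any using (here; there)
open import Data.List.Relation.Unary.Linked using (Linked; []; [-]; _∷_)
open import Data.List.Relation.Unary.Unique.Propositional using (Unique)
import Data.List.Relation.Unary.Unique.Propositional.Properties as Unique
open import Data.List.Reverse using (Reverse; reverseView; []; _∶_∶ʳ_)
open import Data.Nat.Base as ℕ using (ℕ; zero; suc; _≤_; _<_; _<ᵇ_; s≤s; z≤n)
open import Data.Nat.Induction using (<-wellFounded)
open import Data.Nat.ListAction using (sum)
open import Data.Nat.ListAction.Properties using (sum-++; sum-↭)
import Data.Nat.Properties as ℕ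
open import Data.Product.Base using (∃; ∃₂; _×_; _,_; proj₁; proj₂)
open import Data.Sum.Base using (inj₁; inj₂)
open import Data.Vec.Functional using (updateAt)
open import Data.Vec.Functional.Properties using (updateAt-updates; updateAt-minimal)
open import Function.Base using (flip; _∘_; _on_; id)
open import Function.Bundles using (mk⇔)
open import Induction.WellFounded using (Acc; WellFounded; module Subrelation)
open import Level using (Level; _⊔_)
open import Relation.Binary.Bundles using (TotalOrder)
open import Relation.Binary.Core using (Rel)
open import Relation.Binary.Construct.Closure.ReflexiveTransitive using (Star; ε; _◅_)
import Relation.Binary.Construct.On as On
open import Relation.Binary.PropositionalEquality
  using (_≡_; _≢_; refl; sym; trans; cong; subst; setoid)
open import Relation.Nullary.Decidable using (yes; no; ¬?; _×-dec_)
open import Relation.Nullary.Negation.Core using (¬_; contradiction)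
open import Relation.Unary using (Pred; Decidable)
import Data.List.Membership.DecPropositional as DecMembership

private
  variable
    a p q ℓ : Level
    A : Set a

Unique-resp-↭ : {xs ys : List A} → xs ↭ ys → Unique xs → Unique ys
Unique-resp-↭ xs↭ys = SetoidPermutation.Unique-resp-↭ (setoid _) (↭⇒↭ₛ xs↭ys)

Unique-∷ʳ⁺ : ∀ {xs : List A} {x} → Unique xs → x ∉ xs → Unique (xs ∷ʳ x)
Unique-∷ʳ⁺ {xs = xs} {x} uxs x∉xs =
  Unique-resp-↭ (∷↭∷ʳ x xs) (All.tabulate (λ { y∈xs refl → x∉xs y∈xs }) ∷ uxs)

Unique-∷ʳ⁻ : ∀ {xs : List A} {x} → Unique (xs ∷ʳ x) → Unique xs × x ∉ xs
Unique-∷ʳ⁻ {xs = xs} {x} u with u′@(_ ∷ uxs) ← Unique-resp-↭ (↭-sym (∷↭∷ʳ x xs)) u =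
  uxs , Unique.Unique[x∷xs]⇒x∉xs u′

AllPairs-++⁻ˡ : ∀ {R : Rel A ℓ} xs {ys} → AllPairs R (xs ++ ys) → AllPairs R xs
AllPairs-++⁻ˡ []       _          = []
AllPairs-++⁻ˡ (x ∷ xs) (rx ∷ rxs) = All.++⁻ˡ xs rx ∷ AllPairs-++⁻ˡ xs rxs

AllPairs-++⁻-lookup : ∀ {R : Rel A ℓ} {xs ys x y} → AllPairs R (xs ++ ys) → x ∈ xs → y ∈ ys → R x y
AllPairs-++⁻-lookup {xs = _ ∷ xs} (rx ∷ _)  (here refl)  y∈ys = All.lookup (All.++⁻ʳ xs rx) y∈ys
AllPairs-++⁻-lookup               (_ ∷ rxs) (there x∈xs) y∈ys = AllPairs-++⁻-lookup rxs x∈xs y∈ys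

AllPairs-∷ʳ⁺ : ∀ {R : Rel A ℓ} {xs x} → AllPairs R xs → All (λ y → R y x) xs → AllPairs R (xs ∷ʳ x)
AllPairs-∷ʳ⁺ rxs rx = AllPairs.++⁺ rxs ([] ∷ []) (All.map (_∷ []) rx)

take-∷ʳ : ∀ k (xs : List A) x →
          take k (xs ∷ʳ x) ≡ (if length (take k xs) <ᵇ k then take k xs ∷ʳ x else take k xs)
take-∷ʳ zero    xs       x = refl
take-∷ʳ (suc k) []       x = cong (x ∷_) (take-[] k)
take-∷ʳ (suc k) (y ∷ xs) x with length (take k xs) <ᵇ k | take-∷ʳ k xs x
... | true  | eq = cong (y ∷_) eq
... | false | eq = cong (y ∷_) eq

length-filter-mono : ∀ {P : Pred A p} {Q : Pred A q} (P? : Decidable P) (Q? : Decidable Q) →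
                     (∀ {x} → P x → Q x) → ∀ xs → length (filter P? xs) ≤ length (filter Q? xs)
length-filter-mono P? Q? P⇒Q [] = z≤n
length-filter-mono P? Q? P⇒Q (x ∷ xs) with ih ← length-filter-mono P? Q? P⇒Q xs | P? x | Q? x
... | yes px | yes qx = s≤s ih
... | yes px | no ¬qx = contradiction (P⇒Q px) ¬qx
... | no ¬px | yes qx = ℕ.m≤n⇒m≤1+n ih
... | no ¬px | no ¬qx = ih

length-filter-strictMono : ∀ {P : Pred A p} {Q : Pred A q} (P? : Decidable P) (Q? : Decidable Q) →
                           (∀ {x} → P x → Q x) → ∀ {y xs} → y ∈ xs → Q y → ¬ P y →
                           length (filter P? xs) < length (filter Q? xs)
length-filter-strictMono P? Q? P⇒Q {y} {_ ∷ xs} (here refl) qy ¬py with P? y | Q? y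
... | yes py | _      = contradiction py ¬py
... | no _   | yes _  = s≤s (length-filter-mono P? Q? P⇒Q xs)
... | no _   | no ¬qy = contradiction qy ¬qy
length-filter-strictMono P? Q? P⇒Q {y} {x ∷ xs} (there y∈xs) qy ¬py
  with ih ← length-filter-strictMono P? Q? P⇒Q y∈xs qy ¬py | P? x | Q? x
... | yes px | yes qx = s≤s ih
... | yes px | no ¬qx = contradiction (P⇒Q px) ¬qx
... | no ¬px | yes qx = ℕ.m≤n⇒m≤1+n ih
... | no ¬px | no ¬qx = ih

sum-bounded : ∀ c {N ns} → All (λ n → c ℕ.* n ≤ N) ns → c ℕ.* sum ns ≤ length ns ℕ.* N
sum-bounded c [] rewrite ℕ.*-zeroʳ c = z≤n
sum-bounded c {N} {n ∷ ns} (cn≤N ∷ rest) = begin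
  c ℕ.* (n ℕ.+ sum ns)        ≡⟨ ℕ.*-distribˡ-+ c n (sum ns) ⟩
  c ℕ.* n ℕ.+ c ℕ.* sum ns    ≤⟨ ℕ.+-mono-≤ cn≤N (sum-bounded c rest) ⟩
  N ℕ.+ length ns ℕ.* N       ∎
  where open ℕ.≤-Reasoning

sum-small : ∀ {m N ns} → 0 < N → length ns ≤ m → All (λ n → suc m ℕ.* n ≤ N) ns → sum ns < N
sum-small {m} {N} {ns} 0<N len small = ℕ.*-cancelˡ-< (suc m) (sum ns) N (begin-strict
  suc m ℕ.* sum ns ≤⟨ sum-bounded (suc m) small ⟩
  length ns ℕ.* N  ≤⟨ ℕ.*-monoˡ-≤ N len ⟩
  m ℕ.* N          <⟨ ℕ.+-monoˡ-≤ (m ℕ.* N) 0<N ⟩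
  suc m ℕ.* N      ∎)
  where open ℕ.≤-Reasoning

module _ {c ℓ₁ ℓ₂} (O : TotalOrder c ℓ₁ ℓ₂) where
  private module O = TotalOrder O

  minimum-first : ∀ (f : A → O.Carrier) x xs → ∃₂ λ y ys →
                  (x ∷ xs) ↭ (y ∷ ys) × All (λ z → f y O.≤ f z) ys
  minimum-first f x [] = x , [] , ↭-refl , []
  minimum-first f x (x′ ∷ xs) with minimum-first f x′ xs
  ... | y , ys , x′xs↭yys , y≤ys with O.total (f x) (f y)
  ...   | inj₁ x≤y = x , x′ ∷ xs , ↭-refl ,
                     All-resp-↭ (↭-sym x′xs↭yys) (x≤y ∷ All.map (O.trans x≤y) y≤ys)
  ...   | inj₂ y≤x = y , x ∷ ys , ↭-trans (prep x x′xs↭yys) (swap x y ↭-refl) , y≤x ∷ y≤ys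

last-∷ : ∀ (x y : A) ys → last (x ∷ y ∷ ys) ≡ last (y ∷ ys)
last-∷ x y ys with initLast ys
... | []       = refl
... | _ ∷ʳ′ _ = refl

last-⁺∷ʳ : ∀ (P : List⁺ A) u → last (P ⁺∷ʳ u) ≡ u
last-⁺∷ʳ (x ∷ xs) u = go x xs
  where
  go : ∀ x xs → last (x ∷ xs ∷ʳ u) ≡ u
  go x []       = refl
  go x (y ∷ ys) = trans (last-∷ x y (ys ∷ʳ u)) (go y ys)

toList-injective : ∀ {P Q : List⁺ A} → toList P ≡ toList Q → P ≡ Q
toList-injective refl = refl

⁺∷ʳ-injective : ∀ {P Q : List⁺ A} {u v} → P ⁺∷ʳ u ≡ Q ⁺∷ʳ v → P ≡ Q × u ≡ v
⁺∷ʳ-injective {P = P} {Q} eq with ∷ʳ-injective (toList P) (toList Q) (cong toList eq)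
... | P≡Q , u≡v = toList-injective P≡Q , u≡v

Linked-⁺∷ʳ⁺ : ∀ {R : Rel A ℓ} (P : List⁺ A) {u} →
              Linked R (toList P) → R (last P) u → Linked R (toList (P ⁺∷ʳ u))
Linked-⁺∷ʳ⁺ (x ∷ [])     l       r = r ∷ [-]
Linked-⁺∷ʳ⁺ (x ∷ y ∷ ys) (e ∷ l) r rewrite last-∷ x y ys = e ∷ Linked-⁺∷ʳ⁺ (y ∷ ys) l r

Linked-⁺∷ʳ⁻ : ∀ {R : Rel A ℓ} (P : List⁺ A) {u} →
              Linked R (toList (P ⁺∷ʳ u)) → Linked R (toList P) × R (last P) u
Linked-⁺∷ʳ⁻ (x ∷ [])     (r ∷ [-]) = [-] , r
Linked-⁺∷ʳ⁻ (x ∷ y ∷ ys) (e ∷ l) rewrite last-∷ x y ys with Linked-⁺∷ʳ⁻ (y ∷ ys) l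
... | l′ , r = e ∷ l′ , r

totalOrder : ∀ {c ℓ₁ ℓ₂} → TotallyOrderedAbelianGroup c ℓ₁ ℓ₂ → TotalOrder c ℓ₁ ℓ₂
totalOrder W = record { isTotalOrder = TotallyOrderedAbelianGroup.isTotalOrder W }

module _ {c ℓ₁ ℓ₂} {W : TotallyOrderedAbelianGroup c ℓ₁ ℓ₂} (G : WeightedDigraph W) where
  private
    module W = TotallyOrderedAbelianGroup W
    module O = TotalOrder (totalOrder W)
    module A = IsAbelianGroup W.isAbelianGroup
  open W using (Carrier; _≈_; _+_; 0#)
  open WeightedDigraph G
  open DecMembership (_≟_ {order}) using (_∈?_)

  children : VertexSeq G → List (VertexSeq G)
  children Π = map (Π ⁺∷ʳ_) (freshNeighbours G Π)

  map-proj₁-extensions : ∀ Π → map proj₁ (extensions G Π) ≡ children Π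
  map-proj₁-extensions Π = sym (map-∘ (freshNeighbours G Π))

  ∈-freshNeighbours⁺ : ∀ {Π u} → Edge (last Π) u → u ∉ toList Π → u ∈ freshNeighbours G Π
  ∈-freshNeighbours⁺ {Π} e u∉Π =
    ∈-filter⁺ (λ u → edge? (last Π) u ×-dec ¬? (u ∈? toList Π)) (∈-allFin _) (e , u∉Π)

  ∈-freshNeighbours⁻ : ∀ {Π u} → u ∈ freshNeighbours G Π → Edge (last Π) u × u ∉ toList Π
  ∈-freshNeighbours⁻ {Π} u∈ =
    proj₂ (∈-filter⁻ (λ u → edge? (last Π) u ×-dec ¬? (u ∈? toList Π)) {xs = allFin order} u∈)

  weight-⁺∷ʳ : ∀ P u → weight G (P ⁺∷ʳ u) ≈ weight G P + ω (last P) u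
  weight-⁺∷ʳ (x ∷ xs) u = go x xs
    where
    go : ∀ x xs → weight G (x ∷ xs ∷ʳ u) ≈ weight G (x ∷ xs) + ω (last (x ∷ xs)) u
    go x []       = A.comm _ _
    go x (y ∷ ys) rewrite last-∷ x y ys = A.trans (A.∙-congˡ (go y ys)) (A.sym (A.assoc _ _ _))

  weight≤weight+ω : ∀ {Π u} → u ∈ freshNeighbours G Π → weight G Π W.≤ weight G Π + ω (last Π) u
  weight≤weight+ω {Π} u∈ = O.trans (O.reflexive (A.sym (A.identityʳ _)))
    (W.+-monoʳ-≤ (weight G Π) (ω-nonNeg (proj₁ (∈-freshNeighbours⁻ {Π} u∈))))

  simplePath-⁺∷ʳ⁺ : ∀ {r Π u} → IsSimplePath G r (last Π) Π → u ∈ freshNeighbours G Π →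
                    IsSimplePath G r u (Π ⁺∷ʳ u)
  simplePath-⁺∷ʳ⁺ {r} {Π} {u} (path , unique) u∈ with ∈-freshNeighbours⁻ {Π} u∈
  ... | e , u∉Π =
    record { starts = starts ; ends = last-⁺∷ʳ Π u ; linked = Linked-⁺∷ʳ⁺ Π linked e } ,
    Unique-∷ʳ⁺ unique u∉Π
    where open IsPath path

  simplePath-⁺∷ʳ⁻ : ∀ {r Π u} → IsSimplePath G r u (Π ⁺∷ʳ u) →
                    IsSimplePath G r (last Π) Π × u ∈ freshNeighbours G Π
  simplePath-⁺∷ʳ⁻ {r} {Π} {u} (path , unique)
    with Linked-⁺∷ʳ⁻ Π (IsPath.linked path) | Unique-∷ʳ⁻ unique
  ... | l , e | uΠ , u∉Π =
    (record { starts = IsPath.starts path ; ends = refl ; linked = l } , uΠ) ,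
    ∈-freshNeighbours⁺ {Π} e u∉Π

  simplePath-last : ∀ {r v P} → IsSimplePath G r v P → last P ≡ v
  simplePath-last (path , _) = IsPath.ends path

  trivialPath-simple : ∀ r → IsSimplePath G r r [ r ]
  trivialPath-simple r = record { starts = refl ; ends = refl ; linked = [-] } , [] ∷ []

  children-simple : ∀ {r Π} → IsSimplePath G r (last Π) Π →
                    All (λ P → IsSimplePath G r (last P) P) (children Π)
  children-simple {r} {Π} simple = All.map⁺ (All.tabulate λ {u} u∈ →
    subst (λ v → IsSimplePath G r v (Π ⁺∷ʳ u)) (sym (last-⁺∷ʳ Π u)) (simplePath-⁺∷ʳ⁺ simple u∈))

  children-unique : ∀ Π → Unique (children Π)
  children-unique Π = Unique.map⁺ (proj₂ ∘ ⁺∷ʳ-injective) (Unique.filter⁺ _ (Unique.allFin⁺ order))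

  children-disjoint : ∀ {Π Π′} → Π ≢ Π′ → Disjoint (children Π) (children Π′)
  children-disjoint {Π} {Π′} Π≢Π′ (P∈ , P∈′)
    with ∈-map⁻ (Π ⁺∷ʳ_) P∈ | ∈-map⁻ (Π′ ⁺∷ʳ_) P∈′
  ... | _ , _ , refl | _ , _ , eq = Π≢Π′ (proj₁ (⁺∷ʳ-injective eq))

  [r]∉children : ∀ r Π → [ r ] ∉ children Π
  [r]∉children r Π [r]∈ with ∈-map⁻ (Π ⁺∷ʳ_) [r]∈
  ... | _ , _ , eq = contradiction (cong (length ∘ toList) eq) (length≢ Π)
    where
    length≢ : ∀ Q {u} → 1 ≢ length (toList (Q ⁺∷ʳ u))
    length≢ (_ ∷ [])    ()
    length≢ (_ ∷ _ ∷ _) ()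

  generated : Vertex → List (VertexSeq G) → List (VertexSeq G)
  generated r D = [ r ] ∷ concatMap children D

  generated-∷ʳ : ∀ r D Π → generated r (D ∷ʳ Π) ≡ generated r D ++ children Π
  generated-∷ʳ r D Π = cong ([ r ] ∷_) (trans (concatMap-++ children D (Π ∷ []))
    (cong (concatMap children D ++_) (++-identityʳ (children Π))))

  generated-unique : ∀ r {D} → Unique D → Unique (generated r D)
  generated-unique r {D} uD =
    All.tabulate (λ { P∈ refl → [r]∉ P∈ }) ∷
    Unique.concat⁺ (All.map⁺ (All.universal children-unique D))
                   (AllPairs.map⁺ (AllPairs.map children-disjoint uD))
    where
    [r]∉ : [ r ] ∉ concatMap children D
    [r]∉ [r]∈ with Any.satisfied (∈-concatMap⁻ children {xs = D} [r]∈)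
    ... | Π , [r]∈Π = [r]∉children r Π [r]∈Π

  generated-simple : ∀ r {D} → All (λ P → IsSimplePath G r (last P) P) D →
                     All (λ P → IsSimplePath G r (last P) P) (generated r D)
  generated-simple r simple =
    trivialPath-simple r ∷ All.concat⁺ (All.map⁺ (All.map children-simple simple))

  generated-closed⇒complete : ∀ {r D} → (∀ {P} → P ∈ generated r D → P ∈ D) →
                              ∀ {v P} → IsSimplePath G r v P → P ∈ D
  generated-closed⇒complete {r} {D} closed {P = x ∷ xs} = go (reverseView xs)
    where
    go : ∀ {v xs} → Reverse xs → IsSimplePath G r v (x ∷ xs) → x ∷ xs ∈ D
    go [] (path , _) with refl ← IsPath.starts path = closed (here refl)
    go (xs ∶ xs′ ∶ʳ u) simple
      with refl ← trans (sym (last-⁺∷ʳ (x ∷ xs) u)) (simplePath-last simple)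
      with simplePath-⁺∷ʳ⁻ {Π = x ∷ xs} simple
    ... | simple′ , u∈ = closed (there (∈-concatMap⁺ children
            (Any.map (λ { refl → ∈-map⁺ ((x ∷ xs) ⁺∷ʳ_) u∈ }) (go xs′ simple′))))

  unvisited : VertexSeq G → ℕ
  unvisited Π = length (filter (λ u → ¬? (u ∈? toList Π)) (allFin order))

  unvisited-⁺∷ʳ : ∀ {Π u} → u ∉ toList Π → unvisited (Π ⁺∷ʳ u) < unvisited Π
  unvisited-⁺∷ʳ {Π} {u} u∉Π = length-filter-strictMono _ _
    (λ x∉ x∈Π → x∉ (∈-++⁺ˡ x∈Π)) (∈-allFin u) u∉Π (λ u∉ → u∉ (∈-++⁺ʳ (toList Π) (here refl)))

  -- Paths with u unvisited vertices have potential (|V| + 1) ^ u: an extension has fewer unvisited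
  -- vertices and there are at most |V| of them, so their total is less than that of the path itself.
  potential : VertexSeq G × Carrier → ℕ
  potential (Π , _) = suc order ℕ.^ unvisited Π

  potential-extensions : ∀ Π κ → sum (map potential (extensions G Π)) < potential (Π , κ)
  potential-extensions Π κ = sum-small (ℕ.m^n>0 (suc order) (unvisited Π)) few
    (All.map⁺ (All.map⁺ (All.tabulate λ u∈ →
      ℕ.^-monoʳ-≤ (suc order) (unvisited-⁺∷ʳ {Π} (proj₂ (∈-freshNeighbours⁻ {Π} u∈))))))
    where
    open ℕ.≤-Reasoning
    few : length (map potential (extensions G Π)) ≤ order
    few = begin
      length (map potential (extensions G Π)) ≡⟨ length-map potential (extensions G Π) ⟩
      length (extensions G Π)                 ≡⟨ length-map _ (freshNeighbours G Π) ⟩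
      length (freshNeighbours G Π)            ≤⟨ length-filter _ (allFin order) ⟩
      length (allFin order)                   ≡⟨ length-tabulate {n = order} id ⟩
      order                                   ∎

  step-wellFounded : ∀ k → WellFounded (flip (Step G k))
  step-wellFounded k = Subrelation.wellFounded decreases (On.wellFounded μ <-wellFounded)
    where
    μ : State G → ℕ
    μ s = sum (map potential (PQ s))

    open ℕ.≤-Reasoning
    decreases : ∀ {s′ s} → Step G k s s′ → μ s′ < μ s
    decreases (extractMin {PQ = PQ} {Π} {κ} {rest} PQ↭ _) = begin-strict
      sum (map potential (extensions G Π ++ rest))
        ≡⟨ cong sum (map-++ potential (extensions G Π) rest) ⟩
      sum (map potential (extensions G Π) ++ map potential rest)
        ≡⟨ sum-++ (map potential (extensions G Π)) _ ⟩
      sum (map potential (extensions G Π)) ℕ.+ sum (map potential rest)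
        <⟨ ℕ.+-monoˡ-< _ (potential-extensions Π κ) ⟩
      potential (Π , κ) ℕ.+ sum (map potential rest)
        ≡⟨ sum-↭ (↭-map⁺ potential PQ↭) ⟨
      sum (map potential PQ) ∎

  progress : ∀ k s → PQ s ≢ [] → ∃ λ s′ → Step G k s s′
  progress k ⟨ T , [] ⟩     PQ≢[] = contradiction refl PQ≢[]
  progress k ⟨ T , e ∷ es ⟩ _
    with _ , _ , PQ↭ , min ← minimum-first (totalOrder W) proj₂ e es =
    _ , extractMin PQ↭ min

  pathsTo : Vertex → List (VertexSeq G) → List (VertexSeq G)
  pathsTo v = filter (λ P → last P ≟ v)

  record Invariant (k : ℕ) (r : Vertex) (D : List (VertexSeq G)) (s : State G) : Set (c ⊔ ℓ₁ ⊔ ℓ₂) where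
    field
      recorded : ∀ v → T s v ≡ take k (pathsTo v D)
      explored : D ++ map proj₁ (PQ s) ↭ generated r D
      distinct : Unique D
      simple   : All (λ P → IsSimplePath G r (last P) P) D
      sorted   : AllPairs (W._≤_ on weight G) D
      keyed    : All (λ { (P , κ) → κ ≈ weight G P }) (PQ s)
      frontier : All (λ P → All (λ e → weight G P W.≤ proj₂ e) (PQ s)) D

  invariant-initial : ∀ k r → Invariant k r [] (initial G r)
  invariant-initial k r = record
    { recorded = λ v → sym (take-[] k)
    ; explored = ↭-refl
    ; distinct = []
    ; simple   = []
    ; sorted   = []
    ; keyed    = A.refl ∷ []
    ; frontier = []
    }

  recordPath-take : ∀ k v D Π {T} → T v ≡ take k (pathsTo v D) →
                    updateAt T (last Π) (recordPath G k Π) v ≡ take k (pathsTo v (D ∷ʳ Π))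
  recordPath-take k v D Π {T} Tv≡ rewrite filter-++ (λ P → last P ≟ v) D (Π ∷ []) with last Π ≟ v
  ... | yes refl rewrite updateAt-updates (last Π) {recordPath G k Π} T | Tv≡ =
    sym (take-∷ʳ k (pathsTo v D) Π)
  ... | no Π≢v rewrite updateAt-minimal v (last Π) {recordPath G k Π} T (Π≢v ∘ sym) =
    trans Tv≡ (cong (take k) (sym (++-identityʳ (pathsTo v D))))

  invariant-step : ∀ {k r D s s′} → Invariant k r D s → Step G k s s′ → ∃ λ D′ → Invariant k r D′ s′
  invariant-step {k} {r} {D} {s} inv (extractMin {T} {PQ} {Π} {κ} {rest} PQ↭ min) = D ∷ʳ Π , record
    { recorded = λ v → recordPath-take k v D Π (recorded v)
    ; explored = explored′
    ; distinct = AllPairs-++⁻ˡ (D ∷ʳ Π) seen-unique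
    ; simple   = All.∷ʳ⁺ simple Π-simple
    ; sorted   = AllPairs-∷ʳ⁺ sorted (All.map (λ { (P≤κ ∷ _) → O.trans P≤κ κ≤Π }) frontier↭)
    ; keyed    = All.++⁺ (All.map⁺ (All.tabulate λ {u} _ → A.sym (weight-⁺∷ʳ Π u))) (All.tail keyed↭)
    ; frontier = All.∷ʳ⁺
        (All.map (λ { (P≤κ ∷ P≤rest) → All.++⁺ (extensions-above (O.trans P≤κ κ≤Π)) P≤rest }) frontier↭)
        (All.++⁺ (extensions-above O.refl) (All.map (O.trans (O.reflexive (A.sym κ≈Π))) min))
    }
    where
    open Invariant inv
    R = map proj₁ rest

    keyed↭ = All-resp-↭ PQ↭ keyed
    frontier↭ = All.map (All-resp-↭ PQ↭) frontier
    κ≈Π = All.head keyed↭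
    κ≤Π = O.reflexive κ≈Π

    seen↭ : (D ∷ʳ Π) ++ R ↭ generated r D
    seen↭ = begin
      (D ∷ʳ Π) ++ R       ≡⟨ ∷ʳ-++ D Π R ⟩
      D ++ Π ∷ R          ↭⟨ ++⁺ˡ D (↭-map⁺ proj₁ PQ↭) ⟨
      D ++ map proj₁ PQ   ↭⟨ explored ⟩
      generated r D       ∎
      where open PermutationReasoning

    seen-unique : Unique ((D ∷ʳ Π) ++ R)
    seen-unique = Unique-resp-↭ (↭-sym seen↭) (generated-unique r distinct)

    Π-simple : IsSimplePath G r (last Π) Π
    Π-simple = proj₂ (All.∷ʳ⁻ {xs = D} (All.++⁻ˡ (D ∷ʳ Π)
      (All-resp-↭ (↭-sym seen↭) (generated-simple r simple))))

    explored′ : (D ∷ʳ Π) ++ map proj₁ (extensions G Π ++ rest) ↭ generated r (D ∷ʳ Π)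
    explored′ = begin
      (D ∷ʳ Π) ++ map proj₁ (extensions G Π ++ rest)
        ≡⟨ cong ((D ∷ʳ Π) ++_) (map-++ proj₁ (extensions G Π) rest) ⟩
      (D ∷ʳ Π) ++ map proj₁ (extensions G Π) ++ R
        ≡⟨ cong (λ xs → (D ∷ʳ Π) ++ xs ++ R) (map-proj₁-extensions Π) ⟩
      (D ∷ʳ Π) ++ children Π ++ R
        ↭⟨ ++⁺ˡ (D ∷ʳ Π) (++-comm (children Π) R) ⟩
      (D ∷ʳ Π) ++ R ++ children Π
        ≡⟨ ++-assoc (D ∷ʳ Π) R (children Π) ⟨
      ((D ∷ʳ Π) ++ R) ++ children Π
        ↭⟨ ++⁺ʳ (children Π) seen↭ ⟩
      generated r D ++ children Π
        ≡⟨ generated-∷ʳ r D Π ⟨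
      generated r (D ∷ʳ Π) ∎
      where open PermutationReasoning

    extensions-above : ∀ {x} → x W.≤ weight G Π → All (λ e → x W.≤ proj₂ e) (extensions G Π)
    extensions-above x≤Π = All.map⁺ (All.tabulate (O.trans x≤Π ∘ weight≤weight+ω {Π}))

  invariant-reachable : ∀ {k r D s s′} → Invariant k r D s → Star (Step G k) s s′ →
                        ∃ λ D′ → Invariant k r D′ s′
  invariant-reachable inv ε              = _ , inv
  invariant-reachable inv (step ◅ steps) = invariant-reachable (proj₂ (invariant-step inv step)) steps

  invariant-terminal : ∀ {k r D s} → Invariant k r D s → PQ s ≡ [] →
                       ∀ v → IsTopKSimpleShortestPaths G k r v (T s v)
  invariant-terminal {k} {r} {D} {s} inv PQ≡[] v rewrite Invariant.recorded inv v = record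
    { distinct = Unique.take⁺ k L-unique
    ; simple   = All.take⁺ k (All.tabulate ∈L⇒simple)
    ; topK     = length L , (L , L-unique , (λ P → mk⇔ simple⇒∈L ∈L⇒simple) , refl)
               , (λ |L|<k P-simple → subst (_ ∈_) (sym (take-all k L (ℕ.<⇒≤ |L|<k))) (simple⇒∈L P-simple))
               , (λ k≤|L| → trans (length-take k L) (ℕ.m≤n⇒m⊓n≡m k≤|L|) , lightest)
    }
    where
    open Invariant inv
    L = pathsTo v D

    explored-closed : D ↭ generated r D
    explored-closed = subst (_↭ generated r D)
      (trans (cong (λ es → D ++ map proj₁ es) PQ≡[]) (++-identityʳ D)) explored

    L-unique : Unique L
    L-unique = Unique.filter⁺ (λ P → last P ≟ v) distinct

    ∈L⇒simple : ∀ {P} → P ∈ L → IsSimplePath G r v P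
    ∈L⇒simple P∈L with ∈-filter⁻ (λ P → last P ≟ v) {xs = D} P∈L
    ... | P∈D , refl = All.lookup simple P∈D

    simple⇒∈L : ∀ {P} → IsSimplePath G r v P → P ∈ L
    simple⇒∈L P-simple = ∈-filter⁺ (λ P → last P ≟ v)
      (generated-closed⇒complete (∈-resp-↭ (↭-sym explored-closed)) P-simple)
      (simplePath-last P-simple)

    lightest : ∀ {P Q} → P ∈ take k L → IsSimplePath G r v Q → Q ∉ take k L → weight G P W.≤ weight G Q
    lightest P∈ Q-simple Q∉
      with ∈-++⁻ (take k L) (subst (_ ∈_) (sym (take++drop≡id k L)) (simple⇒∈L Q-simple))
    ... | inj₁ Q∈ = contradiction Q∈ Q∉
    ... | inj₂ Q∈ = AllPairs-++⁻-lookup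
          (subst (AllPairs _) (sym (take++drop≡id k L)) (AllPairs.filter⁺ (λ P → last P ≟ v) sorted)) P∈ Q∈

theorem1 : ∀ {c ℓ₁ ℓ₂} {W : TotallyOrderedAbelianGroup c ℓ₁ ℓ₂} (G : WeightedDigraph W)
    (r : WeightedDigraph.Vertex G) (k : ℕ) → 1 ≤ k →
    Acc (flip (Step G k)) (initial G r)
    × (∀ s → Reachable G k r s → PQ s ≢ [] → ∃ λ s′ → Step G k s s′)
    × (∀ s → Reachable G k r s → PQ s ≡ [] →
    ∀ v → v ≢ r → IsTopKSimpleShortestPaths G k r v (T s v))
theorem1 G r k _ =
  step-wellFounded G k (initial G r) ,
  (λ s _ → progress G k s) ,
  (λ s reachable PQ≡[] v _ → invariant-terminal G
    (proj₂ (invariant-reachable G (invariant-initial G k r) reachable)) PQ≡[] v)
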